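{- Let $n\geq 4$ be an integer. Then $K_n$ and $K_n+K_{n-1}$ are Ramsey equivalent; that is, for every finite simple graph $G$, we have $G\to K_n$ if and only if $G\to K_n+K_{n-1}$.
   Context: All graphs are finite and simple. For graphs $G,H$, $G\to H$ ($G$ is Ramsey for $H$) means that every colouring of the edges of $G$ with the two colours red and blue contains a monochromatic copy of $H$ (a subgraph isomorphic to $H$ all of whose edges have the same colour). Two graphs $H_1,H_2$ are Ramsey equivalent if for every graph $G$, $G\to H_1$ holds if and only if $G\to H_2$ holds. $K_m$ is the complete graph on $m$ vertices, and $H_1+H_2$ denotes the disjoint union of a copy of $H_1$ and a vertex-disjoint copy of $H_2$. -}

module Defs where

open import Data.Nat using (ℕ; _+_)
open import Data.Fin using (Fin; splitAt)
open import Data.Bool using (Bool; true; false; T)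
open import Data.Sum using (_⊎_; inj₁; inj₂)
open import Data.Product using (Σ; _×_; _,_)
open import Relation.Binary.PropositionalEquality using (_≡_)
open import Relation.Nullary using (¬_; does)
open import Function.Definitions using (Injective)
open import Data.Fin using (_≟_)

record Graph : Set where
  field
    v     : ℕ
    adj   : Fin v → Fin v → Bool
    adjSym : ∀ x y → adj x y ≡ adj y x
    adjIrr : ∀ x → adj x x ≡ false
open Graph public

K : ℕ → Graph
K m = record
  { v = m
  ; adj = λ x y → Data.Bool.not (does (x ≟ y))
  ; adjSym = symK
  ; adjIrr = irrK }
  where
    open import Relation.Binary.PropositionalEquality using (refl; sym; cong)
    open import Relation.Nullary using (yes; no)
    symK : ∀ (x y : Fin m) → Data.Bool.not (does (x ≟ y)) ≡ Data.Bool.not (does (y ≟ x))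
    symK x y with x ≟ y | y ≟ x
    ... | yes _ | yes _ = refl
    ... | no _  | no _  = refl
    ... | yes p | no q  = Data.Empty.⊥-elim (q (sym p)) where import Data.Empty
    ... | no p  | yes q = Data.Empty.⊥-elim (p (sym q)) where import Data.Empty
    irrK : ∀ (x : Fin m) → Data.Bool.not (does (x ≟ x)) ≡ false
    irrK x with x ≟ x
    ... | yes _ = refl
    ... | no p  = Data.Empty.⊥-elim (p refl) where import Data.Empty

dunionAdj : (H₁ H₂ : Graph) → Fin (v H₁ + v H₂) → Fin (v H₁ + v H₂) → Bool
dunionAdj H₁ H₂ x y with splitAt (v H₁) x | splitAt (v H₁) y
... | inj₁ a | inj₁ b = adj H₁ a b
... | inj₂ a | inj₂ b = adj H₂ a b
... | inj₁ _ | inj₂ _ = false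
... | inj₂ _ | inj₁ _ = false

dunionSym : (H₁ H₂ : Graph) → ∀ x y → dunionAdj H₁ H₂ x y ≡ dunionAdj H₁ H₂ y x
dunionSym H₁ H₂ x y with splitAt (v H₁) x | splitAt (v H₁) y
... | inj₁ a | inj₁ b = adjSym H₁ a b
... | inj₂ a | inj₂ b = adjSym H₂ a b
... | inj₁ _ | inj₂ _ = Relation.Binary.PropositionalEquality.refl
... | inj₂ _ | inj₁ _ = Relation.Binary.PropositionalEquality.refl

dunionIrr : (H₁ H₂ : Graph) → ∀ x → dunionAdj H₁ H₂ x x ≡ false
dunionIrr H₁ H₂ x with splitAt (v H₁) x
... | inj₁ a = adjIrr H₁ a
... | inj₂ a = adjIrr H₂ a

_⊕_ : Graph → Graph → Graph
H₁ ⊕ H₂ = record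
  { v = v H₁ + v H₂
  ; adj = dunionAdj H₁ H₂
  ; adjSym = dunionSym H₁ H₂
  ; adjIrr = dunionIrr H₁ H₂ }

-- A red/blue colouring of the edges of G: a colour (Bool; true = red,
-- false = blue) for each unordered pair, i.e. a symmetric function.
-- (Values on non-edges are irrelevant.)
record Colouring (G : Graph) : Set where
  field
    col    : Fin (v G) → Fin (v G) → Bool
    colSym : ∀ x y → col x y ≡ col y x
open Colouring public

MonoCopy : (G : Graph) → Colouring G → Bool → (H : Graph) → Set
MonoCopy G χ c H =
  Σ (Fin (v H) → Fin (v G)) λ f →
    Injective _≡_ _≡_ f ×
    (∀ x y → T (adj H x y) → T (adj G (f x) (f y)) × col χ (f x) (f y) ≡ c)

_⟶_ : Graph → Graph → Set
G ⟶ H = (χ : Colouring G) → Σ Bool λ c → MonoCopy G χ c H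

{-# OPTIONS --safe #-}
module Submission where

-- Suppose a colouring χ has no monochromatic K_n + K_{n-1}, and let A be a red K_n (up to swapping
-- the colours).  We recolour G without monochromatic K_n, so that G does not arrow K_n.
-- Every red K_{n-1} meets every red K_n.  If there is a blue K_n, say B, then likewise every blue
-- K_{n-1} meets B, and A and B share at most one vertex; put S = A ∪ B, otherwise S = A.  The rest
-- of G is called the outside; there χ is kept.
--
-- Inside A choose x ∉ B and another vertex s₁; x keeps its edges to the outside, all other
-- vertices of A except s₁ become red to the outside and A is made blue except for the edge x s₁.
-- The only danger is a red K_n through x and s₁, and this is avoided by the choice of colours
-- between s₁ and the outside:
--   if some red K_n A′ avoids x, then s₁ is blue to A′ and red elsewhere, so that such a K_n would
--   leave, with s₁ removed, a red K_{n-1} disjoint from A′; since A′ is red, hardly any blue clique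
--   is created;
--   if all red K_n contain A ∖ B, take s₁ ∉ B and keep its edges to the outside as well: a red K_n
--   containing x and s₁ but no third vertex of A ∖ B does not exist.
-- When B exists it is treated symmetrically, with y and r₁ in the places of x and s₁, and the edges
-- between the two halves are chosen so that S, which has at most 2n ≤ (n-1)² vertices, has a
-- partition into n-1 red cliques and another into n-1 blue cliques (this is where n ≥ 4 enters).

open import Defs
open import Data.Bool using (Bool; true; false; T; _∧_; _∨_; not)
import Data.Bool as Bool
open import Data.Bool.Properties using (∨-comm; T-∧; T-∨; T?; not-¬; not-involutive)
open import Data.Empty using (⊥; ⊥-elim)
open import Data.Fin using (Fin; zero; suc; _≟_; splitAt; _↑ˡ_)
open import Data.Fin.Patterns
open import Data.Fin.Properties using (all?)
import Data.Fin.Properties as Fin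
open import Data.List using (List; []; _∷_; length; filter; take; map; tabulate; lookup; _++_)
open import Data.Bool.ListAction using (any)
open import Data.List.Membership.Propositional using (_∈_; _∉_; find)
open import Data.List.Membership.Propositional.Properties
  using (∈-filter⁻; ∈-∃++; ∈-++⁺ˡ; ∈-++⁺ʳ; ∈-lookup)
open import Data.List.Properties using (filter-all; length-take; length-tabulate; map-∘; map-id; map-++)
open import Data.List.Relation.Unary.All as All using (All; []; _∷_)
open import Data.List.Relation.Unary.All.Properties using (¬Any⇒All¬)
import Data.List.Relation.Unary.All.Properties as AllP
open import Data.List.Relation.Unary.AllPairs as AllPairs using (AllPairs; []; _∷_)
import Data.List.Relation.Unary.AllPairs.Properties as AllPairsP
open import Data.List.Relation.Unary.Any as Any using (here; there)
open import Data.List.Relation.Binary.Permutation.Propositional using (_↭_; ↭-trans; prep)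
open import Data.List.Relation.Binary.Permutation.Propositional.Properties using (shift; ∈-resp-↭; ↭-length)
open import Data.Maybe using (Maybe; just; nothing)
import Data.Maybe.Properties as Maybe
open import Data.Nat using (ℕ; suc; _≤_; _<_; _∸_; _+_; z≤n; s≤s)
open import Data.Nat.Properties using (≤-trans; ≤-reflexive; ≤-pred; <⇒≱; ≰⇒>; m≤n⇒m⊓n≡m)
open import Data.Product using (Σ; ∃; _×_; _,_; proj₁; proj₂; map₂)
open import Data.Sum as Sum using (_⊎_; inj₁; inj₂)
open import Data.Unit using (⊤; tt)
open import Function using (_∘_; id)
open import Function.Bundles using (_⇔_; Equivalence; mk⇔)
open import Relation.Binary.Definitions using (Symmetric)
open import Relation.Binary.PropositionalEquality
open import Relation.Nullary using (¬_; Dec; yes; no; does; ¬?)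
open import Relation.Nullary.Decidable
  using (True; toWitness; decidable-stable; dec-true; dec-false; map′; _×-dec_; _⊎-dec_; _→-dec_)
open import Relation.Unary using (Decidable)

-- Lists with pairwise related entries

module _ {A : Set} {R : A → A → Set} where

  AllPairs-related : Symmetric R → ∀ {xs a b} → AllPairs R xs → a ∈ xs → b ∈ xs → a ≡ b ⊎ R a b
  AllPairs-related R-sym (ps ∷ _)  (here refl) (here refl) = inj₁ refl
  AllPairs-related R-sym (ps ∷ _)  (here refl) (there b∈)  = inj₂ (All.lookup ps b∈)
  AllPairs-related R-sym (ps ∷ _)  (there a∈)  (here refl) = inj₂ (R-sym (All.lookup ps a∈))
  AllPairs-related R-sym (_ ∷ pss) (there a∈)  (there b∈)  = AllPairs-related R-sym pss a∈ b∈

  AllPairs-map-∈ : ∀ {S : A → A → Set} {xs} → (∀ {a b} → a ∈ xs → b ∈ xs → R a b → S a b) →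
                   AllPairs R xs → AllPairs S xs
  AllPairs-map-∈ f []         = []
  AllPairs-map-∈ f (ps ∷ pss) =
    All.tabulate (λ b∈ → f (here refl) (there b∈) (All.lookup ps b∈)) ∷
    AllPairs-map-∈ (λ a∈ b∈ → f (there a∈) (there b∈)) pss

  -- The basis of all counting below: a clique contains at most one vertex of a set without edges of
  -- its colour, so filtering such a set out costs at most one vertex.
  length-filter-independent : ∀ {P : A → Set} (P? : Decidable P) {xs} → AllPairs R xs →
    (∀ {a b} → a ∈ xs → b ∈ xs → ¬ P a → ¬ P b → ¬ R a b) →
    length xs ≤ suc (length (filter P? xs))
  length-filter-independent P? [] _ = z≤n
  length-filter-independent P? {x ∷ xs} (ps ∷ pss) indep with P? x
  ... | yes _  = s≤s (length-filter-independent P? pss (λ a∈ b∈ → indep (there a∈) (there b∈)))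
  ... | no ¬Px = s≤s (≤-reflexive (cong length (sym (filter-all P? (All.tabulate λ {b} b∈ →
      decidable-stable (P? b) λ ¬Pb → indep (here refl) (there b∈) ¬Px ¬Pb (All.lookup ps b∈))))))

  -- Irreflexivity makes the entries of `xs` distinct: removing those equal to `y` costs at most
  -- one, and the rest lies in the shorter list `ys`.
  length-AllPairs-⊆ : (∀ {a} → ¬ R a a) → (∀ (a b : A) → Dec (a ≡ b)) →
    ∀ {xs} ys → AllPairs R xs → All (_∈ ys) xs → length xs ≤ length ys
  length-AllPairs-⊆ irr eq? {[]} ys _ _ = z≤n
  length-AllPairs-⊆ irr eq? {_ ∷ _} [] _ (() ∷ _)
  length-AllPairs-⊆ irr eq? {xs@(_ ∷ _)} (y ∷ ys) ps xs⊆ =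
    ≤-trans (length-filter-independent ≢y? ps (λ {a} {b} _ _ ¬a ¬b r →
               irr (subst₂ R (decidable-stable (eq? a y) ¬a) (decidable-stable (eq? b y) ¬b) r)))
            (s≤s (length-AllPairs-⊆ irr eq? ys (AllPairsP.filter⁺ ≢y? ps) (All.tabulate in-ys)))
    where
      ≢y? : Decidable (λ a → ¬ a ≡ y)
      ≢y? a = ¬? (eq? a y)

      in-ys : ∀ {a} → a ∈ filter ≢y? xs → a ∈ ys
      in-ys a∈ with ∈-filter⁻ ≢y? a∈
      ... | a∈xs , a≢y with All.lookup xs⊆ a∈xs
      ... | here a≡y  = ⊥-elim (a≢y a≡y)
      ... | there a∈ys = a∈ys

-- Monochromatic cliques as lists of vertices

Edge : (G : Graph) → Colouring G → Bool → Fin (v G) → Fin (v G) → Set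
Edge G χ c a b = T (adj G a b) × col χ a b ≡ c

Clique : (G : Graph) → Colouring G → Bool → List (Fin (v G)) → Set
Clique G χ c = AllPairs (Edge G χ c)

Edge-sym : ∀ G χ c → Symmetric (Edge G χ c)
Edge-sym G χ c (e , q) = subst T (adjSym G _ _) e , trans (colSym χ _ _) q

¬loop : ∀ G {a} → ¬ T (adj G a a)
¬loop G = subst T (adjIrr G _)

Edge-irrefl : ∀ G χ c {a} → ¬ Edge G χ c a a
Edge-irrefl G χ c (e , _) = ¬loop G e

CliqueBound : (G : Graph) → Colouring G → Bool → (Fin (v G) → Set) → ℕ → Set
CliqueBound G χ c P j = ∀ {L} → Clique G χ c L → All P L → length L < j

CliqueFree : (G : Graph) → Colouring G → ℕ → Set
CliqueFree G χ n = ∀ {c D} → Clique G χ c D → ¬ (n ≤ length D)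

module Search (G : Graph) (χ : Colouring G) where

  -- Fix a first vertex and search for the others among its neighbours of colour `c`. This makes the
  -- case distinctions on the existence of cliques constructive.
  clique? : ∀ c k {P : Fin (v G) → Set} → Decidable P →
            Dec (∃ λ L → Clique G χ c L × All P L × length L ≡ k)
  clique? c 0       P? = yes ([] , [] , [] , refl)
  clique? c (suc k) P? = map′
    (λ { (a , pa , L , cl , ps , refl) →
         a ∷ L , All.map proj₂ ps ∷ cl , pa ∷ All.map proj₁ ps , refl })
    (λ { (a ∷ L , es ∷ cl , pa ∷ ps , refl) → a , pa , L , cl , All.zip (ps , es) , refl })
    (Fin.any? λ a → P? a ×-dec clique? c k (λ b → P? b ×-dec edge? a b))
    where
      edge? : ∀ a b → Dec (Edge G χ c a b)
      edge? a b = T? _ ×-dec (col χ a b Bool.≟ c)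

  clique-bound : ∀ {c k} {P : Fin (v G) → Set} →
                 ¬ (∃ λ L → Clique G χ c L × All P L × length L ≡ k) → CliqueBound G χ c P k
  clique-bound {k = k} none {L} cl ps = ≰⇒> λ k≤ →
    none (take k L , AllPairsP.take⁺ k cl , AllP.take⁺ k ps , trans (length-take k L) (m≤n⇒m⊓n≡m k≤))

  -- Two distinct common vertices would span an edge of both colours.
  common-vertex-unique : ∀ c {L L′ a b} → Clique G χ c L → Clique G χ (not c) L′ →
                        a ∈ L → b ∈ L → a ∈ L′ → b ∈ L′ → a ≡ b
  common-vertex-unique c cl cl′ a∈ b∈ a∈′ b∈′
    with AllPairs-related (Edge-sym G χ c) cl a∈ b∈ | AllPairs-related (Edge-sym G χ (not c)) cl′ a∈′ b∈′
  ... | inj₁ a≡b      | _             = a≡b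
  ... | _             | inj₁ a≡b      = a≡b
  ... | inj₂ (_ , p)  | inj₂ (_ , q)  = ⊥-elim (not-¬ {c} refl (trans (sym p) q))

-- Choice of the two special vertices of a monochromatic clique

-- Here and below n = 4 + m.
Found : (G : Graph) → Colouring G → ℕ → Set
Found G χ m = ∃ λ c → ∃ λ A → ∃ λ M → Clique G χ c A × length A ≡ 4 + m ×
              Clique G χ c M × All (_∉ A) M × length M ≡ 3 + m

-- The vertices x = apex and s₁ = tip of A, with the colours (tint) from s₁ to the outside.
record Switch (G : Graph) (χ : Colouring G) (m : ℕ) (c : Bool) (A B : List (Fin (v G))) (k : ℕ) : Set where
  field
    apex tip      : Fin (v G)
    rest          : List (Fin (v G))
    perm          : A ↭ apex ∷ tip ∷ rest
    apex∉B        : apex ∉ B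
    tint          : Fin (v G) → Bool
    through-apex  : CliqueBound G χ c (λ a → a ≡ apex ⊎ (a ∉ A × T (adj G tip a) × tint a ≡ c)) (3 + m)
    against-tip   : CliqueBound G χ (not c) (λ a → a ∉ A × a ∉ B × T (adj G tip a) × tint a ≡ not c) k

module Switching (G : Graph) (χ : Colouring G) (m : ℕ) where
  open Search G χ

  V : Set
  V = Fin (v G)

  -- `Found` is the goal itself, so from here on a clique of size n may be assumed to meet every
  -- clique of size n - 1 of its colour.
  extend : ∀ {c A} → Clique G χ c A → length A ≡ 4 + m → Found G χ m ⊎ CliqueBound G χ c (_∉ A) (3 + m)
  extend {c} {A} cl len with clique? c (3 + m) (λ a → ¬? (Any.any? (a ≟_) A))
  ... | yes (M , clM , avoids , lenM) = inj₁ (c , A , M , cl , len , clM , avoids , lenM)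
  ... | no none = inj₂ (clique-bound none)

  pick : ∀ {a : V} {A} → a ∈ A → ∃ λ A′ → A ↭ a ∷ A′
  pick a∈ with ∈-∃++ a∈
  ... | ys , zs , refl = ys ++ zs , shift _ ys zs

  pick-two : ∀ {a : V} {A k} → a ∈ A → length A ≡ 2 + k → ∃ λ t → ∃ λ R → A ↭ a ∷ t ∷ R
  pick-two a∈ len with pick a∈
  ... | []    , p with () ← trans (sym len) (↭-length p)
  ... | t ∷ R , p = t , R , p

  -- Applied with `k` = n - 2 if `B` is a clique of size n, and with `k` = n - 1 if `B` is empty; in
  -- the latter case `boundB` expresses that the other colour has no clique of size n.
  switch : ∀ {c A B k} → Clique G χ c A → length A ≡ 4 + m → Clique G χ (not c) B →
           CliqueBound G χ (not c) (_∉ B) (suc k) → 2 ≤ k → Found G χ m ⊎ Switch G χ m c A B k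
  switch {c} {A} {B} {k} clA lenA clB boundB 2≤k = go (Any.any? avoidable? A∖B)
    where
      ∉B? : Decidable (_∉ B)
      ∉B? a = ¬? (Any.any? (a ≟_) B)

      A∖B : List V
      A∖B = filter ∉B? A

      Avoidable : V → Set
      Avoidable a = ∃ λ L → Clique G χ c L × All (_≢ a) L × length L ≡ 4 + m

      avoidable? : Decidable Avoidable
      avoidable? a = clique? c (4 + m) (λ b → ¬? (b ≟ a))

      3≤|A∖B| : 3 ≤ length A∖B
      -- `A` has at least four vertices and shares at most one with `B`.
      3≤|A∖B| = ≤-trans (s≤s (s≤s (s≤s z≤n))) (≤-pred (≤-trans (≤-reflexive (sym lenA))
        (length-filter-independent ∉B? clA λ {a} {b} a∈A b∈A ¬∉a ¬∉b e →
           Edge-irrefl G χ c (subst (Edge G χ c a) (sym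
             (common-vertex-unique c clA clB a∈A b∈A
               (decidable-stable (Any.any? (a ≟_) B) ¬∉a) (decidable-stable (Any.any? (b ≟_) B) ¬∉b))) e))))

      module Avoiding {a A′} (a∈A : a ∈ A) (a∉B : a ∉ B) (clA′ : Clique G χ c A′) (a∉A′ : All (_≢ a) A′)
                      (hit : CliqueBound G χ c (_∉ A′) (3 + m)) where
        tint : V → Bool
        tint b with Any.any? (b ≟_) A′
        ... | yes _ = not c
        ... | no _  = c

        tint≡c : ∀ {b} → tint b ≡ c → b ∉ A′
        tint≡c {b} q with Any.any? (b ≟_) A′
        ... | yes _ = ⊥-elim (not-¬ {c} refl (sym q))
        ... | no b∉ = b∉

        tint≢c : ∀ {b} → tint b ≡ not c → b ∈ A′
        tint≢c {b} q with Any.any? (b ≟_) A′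
        ... | yes b∈ = b∈
        ... | no _   = ⊥-elim (not-¬ {c} refl q)

        -- Since `A′` has colour `c`, a clique of the other colour inside it has at most one vertex.
        small : ∀ {L} → Clique G χ (not c) L → All (_∈ A′) L → length L < k
        small {[]}        _                    _             = ≤-trans (s≤s z≤n) 2≤k
        small {_ ∷ []}    _                    _             = 2≤k
        small {a ∷ b ∷ _} cl@((e ∷ _) ∷ _) (a∈ ∷ b∈ ∷ _) =
          ⊥-elim (Edge-irrefl G χ (not c) (subst (Edge G χ (not c) a)
            (sym (common-vertex-unique c clA′ cl a∈ b∈ (here refl) (there (here refl)))) e))

        result : Switch G χ m c A B k
        result with pick-two a∈A lenA
        ... | t , R , p = record
          { apex = a ; tip = t ; rest = R ; perm = p ; apex∉B = a∉B ; tint = tint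
          -- The apex and all vertices of tint `c` avoid `A′`, so `hit` applies.
          ; through-apex = λ cl ps → hit cl (All.map
              (λ { (inj₁ refl) a∈A′ → All.lookup a∉A′ a∈A′ refl
                 ; (inj₂ (_ , _ , q)) → tint≡c q }) ps)
          ; against-tip = λ cl ps → small cl (All.map (λ { (_ , _ , _ , q) → tint≢c q }) ps) }

      -- Of three vertices in `A` but not in `B`, `a` becomes the apex and `t` the tip. A clique as
      -- in `through-apex` still avoids the third vertex `z` after `t` is added, so it cannot reach
      -- size n.
      unavoidable : ∀ {D} → Clique G χ c D → (∀ {a} → a ∈ D → a ∈ A × a ∉ B) → All (¬_ ∘ Avoidable) D →
                    3 ≤ length D → Switch G χ m c A B k
      unavoidable {[]}         _ _ _ ()
      unavoidable {_ ∷ []}     _ _ _ (s≤s ())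
      unavoidable {_ ∷ _ ∷ []} _ _ _ (s≤s (s≤s ()))
      unavoidable {a ∷ t ∷ z ∷ _} ((eat ∷ eaz ∷ _) ∷ (etz ∷ _) ∷ _) ⊆ (_ ∷ _ ∷ nz ∷ _) _
        with pick (proj₁ (⊆ (here refl)))
      ... | A₁ , p with ∈-resp-↭ p (proj₁ (⊆ (there (here refl))))
      ...   | here refl = ⊥-elim (Edge-irrefl G χ c eat)
      ...   | there t∈ with pick t∈
      ...     | A₂ , p₂ = record
        { apex = a ; tip = t ; rest = A₂ ; perm = ↭-trans p (prep a p₂)
        ; apex∉B = proj₂ (⊆ (here refl)) ; tint = col χ t
        ; through-apex = λ cl ps → ≤-pred (clique-bound nz
            (All.map (λ { (inj₁ refl) → Edge-sym G χ c eat ; (inj₂ (_ , e)) → e }) ps ∷ cl)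
            ((λ { refl → Edge-irrefl G χ c etz }) ∷ All.map
              (λ { (inj₁ refl) refl → Edge-irrefl G χ c eaz
                 ; (inj₂ (b∉A , _)) refl → b∉A (proj₁ (⊆ (there (there (here refl))))) }) ps))
        -- Adding `t` yields a clique avoiding `B`, whence the step from `suc k` to `k`.
        ; against-tip = λ cl ps → ≤-pred (boundB
            (All.map (λ { (_ , _ , e) → e }) ps ∷ cl)
            (proj₂ (⊆ (there (here refl))) ∷ All.map (λ { (_ , b∉B , _) → b∉B }) ps)) }

      go : Dec (Any.Any Avoidable A∖B) → Found G χ m ⊎ Switch G χ m c A B k
      go (yes w) with find w
      ... | a , a∈ , A′ , clA′ , a∉A′ , lenA′ with ∈-filter⁻ ∉B? a∈
      ...   | a∈A , a∉B = Sum.map₂ (Avoiding.result a∈A a∉B clA′ a∉A′) (extend clA′ lenA′)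
      go (no ¬w) = inj₂ (unavoidable (AllPairsP.filter⁺ ∉B? clA) (∈-filter⁻ ∉B?) (¬Any⇒All¬ A∖B ¬w) 3≤|A∖B|)

-- Roles in S and the finite tables of colours

-- The part played by a vertex of S: x and the s's make up A, y and the r's make up B (or B ∖ A, if
-- A and B meet).  All roles are borne by one vertex, except s⁺ and r⁺, which are borne by up to m.
Role : Set
Role = Fin 10

pattern x  = 0F
pattern y  = 1F
pattern s₁ = 2F
pattern s₂ = 3F
pattern s₃ = 4F
pattern s⁺ = 5F
pattern r₁ = 6F
pattern r₂ = 7F
pattern r₃ = 8F
pattern r⁺ = 9F

single : Role → Bool
single s⁺ = false
single r⁺ = false
single _  = true

-- The red cliques {x,s₁}, {r₁,r₂,s₂}, {s₃,y,r₃,r⁺} and the single vertices s⁺ cover S, and so do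
-- the blue cliques {y,r₁}, {x,r₂,s₃}, {r₃,s₁,s₂,s⁺} and the single vertices r⁺.
red : Role → Role → Bool
red x  s₁ = true
red x  y  = true
red s₁ r₁ = true
red s₂ r₁ = true
red s₂ r₂ = true
red s₃ y  = true
red s₃ r₃ = true
red s₃ r⁺ = true
red y  r₂ = true
red y  r₃ = true
red y  r⁺ = true
red r₁ r₁ = true
red r₁ r₂ = true
red r₁ r₃ = true
red r₁ r⁺ = true
red r₂ r₂ = true
red r₂ r₃ = true
red r₂ r⁺ = true
red r₃ r₃ = true
red r₃ r⁺ = true
red r⁺ r⁺ = true
red _  _  = false

-- `red` lists each red pair in one order only. The diagonal colours the edges among the bearers of
-- `s⁺` blue and those among the bearers of `r⁺` red.
inner : Role → Role → Bool
inner k l = red k l ∨ red l k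

-- Tells whether the recolouring allows this colour between the role and the outside: `s₂`, `s₃`,
-- `s⁺` are red to the outside and `r₂`, `r₃`, `r⁺` blue, while for the other roles the colour
-- depends on the vertices.
outerCompatible : Bool → Role → Bool
outerCompatible true  r₂ = false
outerCompatible true  r₃ = false
outerCompatible true  r⁺ = false
outerCompatible false s₂ = false
outerCompatible false s₃ = false
outerCompatible false s⁺ = false
outerCompatible _     _  = true

-- The label nothing marks the vertices outside S.
Label : Set
Label = Maybe Role

_==_ : Label → Label → Bool
k == l = does (Maybe.≡-dec _≟_ k l)

==-refl : ∀ k → T (k == k)
==-refl k = subst T (sym (dec-true (Maybe.≡-dec _≟_ k k) refl)) tt

==⇒≡ : ∀ {k l} → T (k == l) → k ≡ l
==⇒≡ {k} {l} t with Maybe.≡-dec _≟_ k l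
... | yes k≡l = k≡l

-- The first label belongs to a vertex known to lie in the clique, the second is tested against it.
-- Equal labels pass because the vertex is tested against itself too, and a labelled vertex never
-- rules out the outside.
compatible : Bool → Label → Label → Bool
compatible c nothing  nothing  = true
compatible c nothing  (just l) = outerCompatible c l
compatible c (just k) nothing  = true
compatible c (just k) (just l) = (just k == just l) ∨ does (inner k l Bool.≟ c)

outside+ without : List Role → Label → Bool
outside+ ks nothing  = true
outside+ ks (just k) = any (λ l → just k == just l) ks
without ks k = not (any (λ l → k == just l) ks)

x-or-s : Label → Bool
x-or-s = outside+ (x ∷ s₁ ∷ s₂ ∷ s₃ ∷ s⁺ ∷ [])

differs : Label → Label → Bool
differs k l = not (k == l)

-- Among vertices labelled in q but not in p, a clique of colour c has at most one element.
Independent : Bool → (q p : Label → Bool) → Set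
Independent c q p = (T (q nothing) → T (p nothing)) ×
  (∀ k l → T (q (just k)) → T (q (just l)) →
    T (p (just k)) ⊎ T (p (just l)) ⊎ (k ≡ l × T (single k)) ⊎ inner k l ≢ c)

independent? : ∀ c q p → Dec (Independent c q p)
independent? c q p = (T? _ →-dec T? _) ×-dec all? λ k → all? λ l → T? _ →-dec (T? _ →-dec
  (T? _ ⊎-dec (T? _ ⊎-dec ((k ≟ l ×-dec T? _) ⊎-dec ¬? (inner k l Bool.≟ c)))))

Includes : (q p : Label → Bool) → Set
Includes q p = (T (q nothing) → T (p nothing)) × (∀ k → T (q (just k)) → T (p (just k)))

includes? : ∀ q p → Dec (Includes q p)
includes? q p = (T? _ →-dec T? _) ×-dec all? λ k → T? _ →-dec T? _

includes : ∀ {q p} → Includes q p → ∀ k → T (q k) → T (p k)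
includes (i , _) nothing  = i
includes (_ , f) (just k) = f k

T-∧⁺ : ∀ {a b} → T a → T b → T (a ∧ b)
T-∧⁺ ta tb = Equivalence.from T-∧ (ta , tb)

-- The recolouring and its large cliques

module Recolour
  (G : Graph) (χ : Colouring G) (m : ℕ)
  (ρ : Fin (v G) → Label) (point : Role → Fin (v G))
  (sR rR : List (Fin (v G))) (|sR|≤m : length sR ≤ m) (|rR|≤m : length rR ≤ m)
  (ρ-single : ∀ {a k} → ρ a ≡ just k → T (single k) → a ≡ point k)
  (ρ-s⁺ : ∀ {a} → ρ a ≡ just s⁺ → a ∈ sR)
  (ρ-r⁺ : ∀ {a} → ρ a ≡ just r⁺ → a ∈ rR)
  (σ τ : Fin (v G) → Bool)
  where

  V : Set
  V = Fin (v G)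

  outer : Role → V → V → Bool
  outer x  a w = col χ a w
  outer y  a w = col χ a w
  outer s₁ a w = σ w
  outer r₁ a w = τ w
  -- The remaining roles admit a single colour to the outside, which is red exactly if red is
  -- allowed.
  outer k  a w = outerCompatible true k

  paint : Label → Label → V → V → Bool
  paint nothing  nothing  a b = col χ a b
  paint nothing  (just l) a b = outer l b a
  paint (just k) nothing  a b = outer k a b
  paint (just k) (just l) a b = inner k l

  paint-sym : ∀ k l a b → paint k l a b ≡ paint l k b a
  paint-sym nothing  nothing  a b = colSym χ a b
  paint-sym nothing  (just l) a b = refl
  paint-sym (just k) nothing  a b = refl
  paint-sym (just k) (just l) a b = ∨-comm (red k l) (red l k)

  recoloured : Colouring G
  recoloured = record
    { col    = λ a b → paint (ρ a) (ρ b) a b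
    ; colSym = λ a b → paint-sym (ρ a) (ρ b) a b }

  New : Bool → V → V → Set
  New = Edge G recoloured

  outer-compatible : ∀ c l {a w} → outer l a w ≡ c → T (outerCompatible c l)
  outer-compatible true  x  _ = tt
  outer-compatible true  y  _ = tt
  outer-compatible true  s₁ _ = tt
  outer-compatible true  s₂ _ = tt
  outer-compatible true  s₃ _ = tt
  outer-compatible true  s⁺ _ = tt
  outer-compatible true  r₁ _ = tt
  outer-compatible true  r₂ ()
  outer-compatible true  r₃ ()
  outer-compatible true  r⁺ ()
  outer-compatible false x  _ = tt
  outer-compatible false y  _ = tt
  outer-compatible false s₁ _ = tt
  outer-compatible false s₂ ()
  outer-compatible false s₃ ()
  outer-compatible false s⁺ ()
  outer-compatible false r₁ _ = tt
  outer-compatible false r₂ _ = tt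
  outer-compatible false r₃ _ = tt
  outer-compatible false r⁺ _ = tt

  -- A large subclique of D with known labels; restrict and refine record what is known about the
  -- labels in D, and drop discards at most one vertex.
  record Part (c : Bool) (D : List V) (q : Label → Bool) (j : ℕ) : Set where
    field
      list   : List V
      clique : AllPairs (New c) list
      ⊆D     : ∀ {a} → a ∈ list → a ∈ D
      labels : All (T ∘ q ∘ ρ) list
      size   : j ≤ length list
  open Part

  whole : ∀ {c D j} → AllPairs (New c) D → j ≤ length D → Part c D (λ _ → true) j
  whole cl j≤ = record { list = _ ; clique = cl ; ⊆D = λ a∈ → a∈
                       ; labels = All.universal (λ _ → tt) _ ; size = j≤ }

  refine : ∀ {c D q j} (p : Label → Bool) (L : Part c D q j) → (∀ {a} → a ∈ D → T (p (ρ a))) →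
           Part c D (λ k → q k ∧ p k) j
  refine p L hyp = record
    { list = list L ; clique = clique L ; ⊆D = ⊆D L ; size = size L
    ; labels = All.tabulate λ a∈ → T-∧⁺ (All.lookup (labels L) a∈) (hyp (⊆D L a∈)) }

  -- Two bearers of a single role coincide and would form a loop; any other pair of discarded
  -- vertices has the wrong colour in the table.
  independent : ∀ {c q p} → Independent c q p → ∀ {a b} →
    T (q (ρ a)) → T (q (ρ b)) → ¬ T (p (ρ a)) → ¬ T (p (ρ b)) → ¬ New c a b
  independent {c} {q} {p} (i , f) {a} {b} qa qb ¬pa ¬pb (e , eq) =
    go (ρ a) (ρ b) refl refl qa qb ¬pa ¬pb eq
    where
      go : ∀ k l → ρ a ≡ k → ρ b ≡ l → T (q k) → T (q l) → ¬ T (p k) → ¬ T (p l) →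
           paint k l a b ≡ c → ⊥
      go nothing  _        _  _  qk _  ¬pk _   _ = ¬pk (i qk)
      go (just _) nothing  _  _  _  ql _   ¬pl _ = ¬pl (i ql)
      go (just k) (just l) ρa ρb qk ql ¬pk ¬pl eq with f k l qk ql
      ... | inj₁ pk                        = ¬pk pk
      ... | inj₂ (inj₁ pl)                 = ¬pl pl
      ... | inj₂ (inj₂ (inj₂ ≢c))          = ≢c eq
      ... | inj₂ (inj₂ (inj₁ (refl , sg))) =
        ¬loop G (subst (λ w → T (adj G w b)) a≡b e)
        where a≡b = trans (ρ-single ρa sg) (sym (ρ-single ρb sg))

  -- At each use `q` and `p` are closed terms, so evaluation of the finite check supplies the
  -- implicit argument.
  drop : ∀ {c D q j} (p : Label → Bool) (L : Part c D q (suc j)) → {True (independent? c q p)} →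
         Part c D (λ k → q k ∧ p k) j
  drop {c} {D} {q} p L {ind} = record
    { list = filter p? (list L)
    ; clique = AllPairsP.filter⁺ p? (clique L)
    ; ⊆D = λ a∈ → ⊆D L (proj₁ (∈-filter⁻ p? a∈))
    ; labels = All.tabulate λ a∈ → T-∧⁺ (All.lookup (labels L) (proj₁ (∈-filter⁻ p? a∈)))
                                        (proj₂ (∈-filter⁻ p? {xs = list L} a∈))
    ; size = ≤-pred (≤-trans (size L) (length-filter-independent p? (clique L)
        λ a∈ b∈ → independent {c} {q} {p} (toWitness ind)
                    (All.lookup (labels L) a∈) (All.lookup (labels L) b∈))) }
    where
      p? : Decidable (T ∘ p ∘ ρ)
      p? a = T? (p (ρ a))

  New-sym : ∀ c → Symmetric (New c)
  New-sym = Edge-sym G recoloured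

  compatible-labels : ∀ {c D a b} → AllPairs (New c) D → a ∈ D → b ∈ D →
                      T (compatible c (ρ a) (ρ b))
  compatible-labels {c} {D} {a} {b} cl a∈ b∈ with AllPairs-related (New-sym c) cl a∈ b∈
  ... | inj₁ refl     = diagonal (ρ a)
    where
      diagonal : ∀ k → T (compatible c k k)
      diagonal nothing  = tt
      diagonal (just k) = Equivalence.from T-∨ (inj₁ (==-refl (just k)))
  ... | inj₂ (_ , eq) = go (ρ a) (ρ b) eq
    where
      go : ∀ k l → paint k l a b ≡ c → T (compatible c k l)
      go nothing  nothing  _  = tt
      go nothing  (just l) eq = outer-compatible c l eq
      go (just k) nothing  _  = tt
      go (just k) (just l) eq = Equivalence.from (T-∨ {just k == just l})
                                  (inj₂ (subst T (sym (dec-true (_ Bool.≟ c) eq)) tt))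

  Has : Label → List V → Set
  Has k D = ∃ λ a → a ∈ D × ρ a ≡ k

  has? : ∀ k D → Has k D ⊎ (∀ {a} → a ∈ D → T (differs k (ρ a)))
  has? k D with Any.any? (λ a → T? (k == ρ a)) D
  ... | yes h with find h
  ...   | a , a∈ , t = inj₁ (a , a∈ , sym (==⇒≡ t))
  has? k D | no ¬h = inj₂ (λ a∈ → T-not (All.lookup (¬Any⇒All¬ D ¬h) a∈))
    where
      T-not : ∀ {b} → ¬ T b → T (not b)
      T-not {true}  ¬t = ¬t tt
      T-not {false} _  = tt

  restrict : ∀ {c D q j k} → Has k D → AllPairs (New c) D → Part c D q j →
             Part c D (λ l → q l ∧ compatible c k l) j
  restrict {c} (a , a∈ , refl) cl L = refine (compatible c (ρ a)) L (compatible-labels cl a∈)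

  OutsideOr : Role → V → Set
  OutsideOr z a = ρ a ≡ nothing ⊎ ρ a ≡ just z

  outside-or : ∀ {c D q j} z (L : Part c D q j) → {True (includes? q (outside+ (z ∷ [])))} →
               All (OutsideOr z) (list L)
  outside-or {q = q} z L {inc} = All.map
    (λ {a} qa → go (ρ a) (includes {q} {outside+ (z ∷ [])} (toWitness inc) (ρ a) qa)) (labels L)
    where
      go : ∀ k → T (outside+ (z ∷ []) k) → k ≡ nothing ⊎ k ≡ just z
      go nothing  _ = inj₁ refl
      go (just k) t with T? (just k == just z)
      ... | yes k≡z = inj₂ (==⇒≡ k≡z)
      ... | no k≢z  = ⊥-elim (Sum.[ k≢z , (λ ()) ] (Equivalence.to T-∨ t))

  Original : Role → Set
  Original z = T (single z) × (∀ a w → outer z a w ≡ col χ a w)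

  -- An edge here either lies outside S or joins the only bearer of `z` to the outside; the
  -- recolouring changes neither kind.
  original : ∀ {c z L} → Original z → AllPairs (New c) L → All (OutsideOr z) L → Clique G χ c L
  original {c} {z} (sg , orig) cl ls = AllPairs-map-∈ (λ a∈ b∈ → go (All.lookup ls a∈) (All.lookup ls b∈)) cl
    where
      go : ∀ {a b} → OutsideOr z a → OutsideOr z b → New c a b → Edge G χ c a b
      go (inj₁ ρa) (inj₁ ρb) (e , eq) rewrite ρa | ρb = e , eq
      go (inj₁ ρa) (inj₂ ρb) (e , eq) rewrite ρa | ρb = e , trans (colSym χ _ _) (trans (sym (orig _ _)) eq)
      go (inj₂ ρa) (inj₁ ρb) (e , eq) rewrite ρa | ρb = e , trans (sym (orig _ _)) eq
      go (inj₂ ρa) (inj₂ ρb) (e , _)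
        with refl ← trans (ρ-single ρa sg) (sym (ρ-single ρb sg)) = ⊥-elim (¬loop G e)

  attached : ∀ {c D z a b} → AllPairs (New c) D → T (single z) → a ∈ D → ρ a ≡ just z →
             b ∈ D → ρ b ≡ nothing → T (adj G (point z) b) × outer z (point z) b ≡ c
  attached {c} cl sg a∈ ρa b∈ ρb with ρ-single ρa sg | AllPairs-related (New-sym c) cl a∈ b∈
  ... | refl | inj₁ refl     with () ← trans (sym ρa) ρb
  ... | refl | inj₂ (e , eq) rewrite ρa | ρb = e , eq

  all-outside : ∀ {c D q j} (L : Part c D q j) → {True (includes? q (outside+ []))} →
                All (λ a → ρ a ≡ nothing) (list L)
  all-outside {q = q} L {inc} =
    All.map (λ {a} qa → go (ρ a) (includes {q} {outside+ []} (toWitness inc) (ρ a) qa)) (labels L)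
    where
      go : ∀ k → T (outside+ [] k) → k ≡ nothing
      go nothing _ = refl

  all-labelled : ∀ {c D q j} z (L : Part c D q j) → {True (includes? q (just z ==_))} →
                 All (λ a → ρ a ≡ just z) (list L)
  all-labelled {q = q} z L {inc} =
    All.map (λ {a} qa → sym (==⇒≡ (includes {q} {just z ==_} (toWitness inc) (ρ a) qa))) (labels L)

  confined : ∀ {c D q j} {ws} (L : Part c D q j) → All (_∈ ws) (list L) → j ≤ length ws
  confined {c} {ws = ws} L L⊆ws =
    ≤-trans (size L) (length-AllPairs-⊆ (Edge-irrefl G recoloured c) _≟_ ws (clique L) L⊆ws)

  Tied : Role → Bool → V → Set
  Tied z c a = ρ a ≡ nothing × T (adj G (point z) a) × outer z (point z) a ≡ c

  tied : ∀ {c D z} → AllPairs (New c) D → T (single z) → Has (just z) D →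
         ∀ {b} → b ∈ D → ρ b ≡ nothing → Tied z c b
  tied cl sg (a , a∈ , ρa) b∈ ρb = ρb , attached cl sg a∈ ρa b∈ ρb

  all-tied : ∀ {c D q j z} → AllPairs (New c) D → T (single z) → Has (just z) D →
             (L : Part c D q j) → All (λ a → ρ a ≡ nothing) (list L) → All (Tied z c) (list L)
  all-tied cl sg h L out = All.tabulate λ a∈ → tied cl sg h (⊆D L a∈) (All.lookup out a∈)

  all-tied-or : ∀ {c D q j z t} → AllPairs (New c) D → T (single z) → T (single t) → Has (just z) D →
                (L : Part c D q j) → All (OutsideOr t) (list L) →
                All (λ a → a ≡ point t ⊎ Tied z c a) (list L)
  all-tied-or {z = z} {t} cl sg sgt h L ls = All.tabulate λ a∈ → go a∈ (All.lookup ls a∈)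
    where
      go : ∀ {a} → a ∈ list L → OutsideOr t a → a ≡ point t ⊎ Tied z _ a
      go a∈ (inj₁ ρa) = inj₂ (tied cl sg h (⊆D L a∈) ρa)
      go a∈ (inj₂ ρa) = inj₁ (ρ-single ρa sgt)

  -- Absence of monochromatic cliques of size n after recolouring

  Bound : Bool → (V → Set) → ℕ → Set
  Bound = CliqueBound G χ

  x-original : Original x
  x-original = tt , λ _ _ → refl

  y-original : Original y
  y-original = tt , λ _ _ → refl

  -- If `D` leaves S, an outside vertex in it excludes `r₂`, `r₃` and `r⁺`. According to whether `D`
  -- contains `r₁`, or else `s₁`, or neither, what remains after the drops is a red clique of `χ`
  -- too large for `Pr`, `Px` or `Hy`.
  no-red : Bound true (OutsideOr y) (3 + m) →
           Bound true (λ a → a ≡ point x ⊎ Tied s₁ true a) (3 + m) →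
           Bound true (Tied r₁ true) (2 + m) →
           ∀ {D} → AllPairs (New true) D → ¬ (4 + m ≤ length D)
  no-red Hy Px Pr {D} cl big with has? nothing D
  ... | inj₂ inside = <⇒≱ (s≤s |rR|≤m) (confined L (All.map ρ-r⁺ (all-labelled r⁺ L)))
    where
      -- Each of the three blue cliques of the partition costs at most one vertex, which leaves m +
      -- 1 vertices for at most m bearers of `r⁺`.
      L = drop (without (r₃ ∷ s₁ ∷ s₂ ∷ s⁺ ∷ []))
         (drop (without (x ∷ r₂ ∷ s₃ ∷ []))
         (drop (without (y ∷ r₁ ∷ []))
         (refine (differs nothing) (whole cl big) inside)))
  ... | inj₁ u with has? (just r₁) D
  ...   | inj₁ hr = <⇒≱ (Pr (original {z = x} x-original (clique L) (All.map inj₁ out))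
                            (all-tied cl tt hr L out)) (size L)
    where
      -- Of the other roles still possible only `s₁` and `s₂` are red to `r₁`, and they are blue to
      -- each other.
      L = drop (without (r₁ ∷ []))
         (drop (without (s₁ ∷ s₂ ∷ s₃ ∷ s⁺ ∷ []))
         (restrict hr cl (restrict u cl (whole cl big))))
      out = all-outside L
  ...   | inj₂ ¬r with has? (just s₁) D
  ...     | inj₁ hs = <⇒≱ (Px (original x-original (clique L) out)
                              (all-tied-or cl tt tt hs L out)) (size L)
    where
      -- Of the other roles still possible only `x` is red to `s₁`.
      L = drop (without (s₁ ∷ s₂ ∷ s₃ ∷ s⁺ ∷ []))
         (restrict hs cl (refine (differs (just r₁)) (restrict u cl (whole cl big)) ¬r))
      out = outside-or x L
  ...     | inj₂ ¬s = <⇒≱ (Hy (original y-original (clique L) out) out) (size L)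
    where
      L = drop (without (x ∷ s₂ ∷ s₃ ∷ s⁺ ∷ []))
         (refine (differs (just s₁)) (refine (differs (just r₁)) (restrict u cl (whole cl big)) ¬r) ¬s)
      out = outside-or y L

  no-blue-inside : ∀ {D} → AllPairs (New false) D → (∀ {a} → a ∈ D → T (differs nothing (ρ a))) →
                   ¬ (4 + m ≤ length D)
  no-blue-inside cl inside big = <⇒≱ (s≤s |sR|≤m) (confined L (All.map ρ-s⁺ (all-labelled s⁺ L)))
    where
      L = drop (without (s₃ ∷ y ∷ r₃ ∷ r⁺ ∷ []))
         (drop (without (r₁ ∷ r₂ ∷ s₂ ∷ []))
         (drop (without (x ∷ s₁ ∷ []))
         (refine (differs nothing) (whole cl big) inside)))

  -- The cases of `no-red` with the two halves exchanged and one further split: `x` and `r₁` are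
  -- joined in blue, so `r₁` does not exclude `x`. If both lie in `D`, the red pair `x`, `y`
  -- excludes `y`, and `Hx` applies.
  no-blue : Bound false (OutsideOr x) (3 + m) →
            Bound false (λ a → a ≡ point y ⊎ Tied r₁ false a) (3 + m) →
            Bound false (Tied s₁ false) (2 + m) →
            ∀ {D} → AllPairs (New false) D → ¬ (4 + m ≤ length D)
  no-blue Hx Py Ps {D} cl big with has? nothing D
  ... | inj₂ inside = no-blue-inside cl inside big
  ... | inj₁ u with has? (just s₁) D
  ...   | inj₁ hs = <⇒≱ (Ps (original {z = x} x-original (clique L) (All.map inj₁ out))
                            (all-tied cl tt hs L out)) (size L)
    where
      -- `x` and `r₁` are red to `s₁`, hence absent, and `y`, `r₂`, `r₃`, `r⁺` form a red clique.
      L = drop (without (s₁ ∷ []))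
         (drop (without (y ∷ r₂ ∷ r₃ ∷ r⁺ ∷ []))
         (restrict hs cl (restrict u cl (whole cl big))))
      out = all-outside L
  ...   | inj₂ ¬s with has? (just r₁) D | has? (just x) D
  ...     | inj₁ hr | inj₁ hx = <⇒≱ (Hx (original x-original (clique L) out) out) (size L)
    where
      L = drop (without (r₁ ∷ r₂ ∷ r₃ ∷ r⁺ ∷ []))
         (restrict hx cl (refine (differs (just s₁)) (restrict u cl (whole cl big)) ¬s))
      out = outside-or x L
  ...     | inj₁ hr | inj₂ ¬x = <⇒≱ (Py (original y-original (clique L) out)
                                        (all-tied-or cl tt tt hr L out)) (size L)
    where
      L = drop (without (r₁ ∷ r₂ ∷ r₃ ∷ r⁺ ∷ []))
         (refine (differs (just x)) (refine (differs (just s₁)) (restrict u cl (whole cl big)) ¬s) ¬x)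
      out = outside-or y L
  ...     | inj₂ ¬r | _ = <⇒≱ (Hx (original x-original (clique L) out) out) (size L)
    where
      L = drop (without (y ∷ r₂ ∷ r₃ ∷ r⁺ ∷ []))
         (refine (differs (just r₁)) (refine (differs (just s₁)) (restrict u cl (whole cl big)) ¬s) ¬r)
      out = outside-or x L

  -- Without a second half at most `s₁` has to be discarded, so bounds larger by one suffice.
  no-blue-alone : (∀ a → T (x-or-s (ρ a))) →
                  Bound false (OutsideOr x) (4 + m) →
                  Bound false (Tied s₁ false) (3 + m) →
                  ∀ {D} → AllPairs (New false) D → ¬ (4 + m ≤ length D)
  no-blue-alone alone Hx Ps {D} cl big with has? nothing D
  ... | inj₂ inside = no-blue-inside cl inside big
  ... | inj₁ u with has? (just s₁) D
  ...   | inj₁ hs = <⇒≱ (Ps (original {z = x} x-original (clique L) (All.map inj₁ out))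
                            (all-tied cl tt hs L out)) (size L)
    where
      L = drop (without (s₁ ∷ []))
         (refine x-or-s
         (restrict hs cl (restrict u cl (whole cl big))) (λ {a} _ → alone a))
      out = all-outside L
  ...   | inj₂ ¬s = <⇒≱ (Hx (original x-original (clique L) out) out) (size L)
    where
      L = refine x-or-s
         (refine (differs (just s₁)) (restrict u cl (whole cl big)) ¬s) (λ {a} _ → alone a)
      out = outside-or x L

  Outside : List V → Set
  Outside A = ∀ {a} → ρ a ≡ nothing → a ∉ A

  outside-or-∉ : ∀ {A z} → Outside A → point z ∉ A → T (single z) → ∀ {a} → OutsideOr z a → a ∉ A
  outside-or-∉ out z∉ sg (inj₁ ρa) = out ρa
  outside-or-∉ {A} out z∉ sg (inj₂ ρa) = subst (_∉ A) (sym (ρ-single ρa sg)) z∉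

  monochromatic-free : ∀ {A B} → Outside A → Outside B → point y ∉ A → point x ∉ B →
    Bound true  (_∉ A) (3 + m) →
    Bound false (_∉ B) (3 + m) →
    Bound true  (λ a → a ≡ point x ⊎ (a ∉ A × T (adj G (point s₁) a) × σ a ≡ true)) (3 + m) →
    Bound false (λ a → a ∉ A × a ∉ B × T (adj G (point s₁) a) × σ a ≡ false) (2 + m) →
    Bound false (λ a → a ≡ point y ⊎ (a ∉ B × T (adj G (point r₁) a) × τ a ≡ false)) (3 + m) →
    Bound true  (λ a → a ∉ B × a ∉ A × T (adj G (point r₁) a) × τ a ≡ true) (2 + m) →
    CliqueFree G recoloured (4 + m)
  monochromatic-free outA outB y∉A x∉B hitA hitB throughA againstA throughB againstB {true} = no-red
    (λ cl ps → hitA cl (All.map (outside-or-∉ outA y∉A tt) ps))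
    (λ cl ps → throughA cl (All.map (Sum.map₂ λ (q , e) → outA q , e) ps))
    (λ cl ps → againstB cl (All.map (λ (q , e) → outB q , outA q , e) ps))
  monochromatic-free outA outB y∉A x∉B hitA hitB throughA againstA throughB againstB {false} = no-blue
    (λ cl ps → hitB cl (All.map (outside-or-∉ outB x∉B tt) ps))
    (λ cl ps → throughB cl (All.map (Sum.map₂ λ (q , e) → outB q , e) ps))
    (λ cl ps → againstA cl (All.map (λ (q , e) → outA q , outB q , e) ps))

  monochromatic-free-alone : ∀ {A} → Outside A → (∀ a → T (x-or-s (ρ a))) → (∀ a → τ a ≡ false) →
    Bound true  (_∉ A) (3 + m) →
    Bound false (λ _ → ⊤) (4 + m) →
    Bound true  (λ a → a ≡ point x ⊎ (a ∉ A × T (adj G (point s₁) a) × σ a ≡ true)) (3 + m) →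
    Bound false (λ a → a ∉ A × a ∉ [] × T (adj G (point s₁) a) × σ a ≡ false) (3 + m) →
    CliqueFree G recoloured (4 + m)
  monochromatic-free-alone outA alone τ≡false hitA no-original through against {true} = no-red
    (λ cl ps → hitA cl (All.map (λ { (inj₁ q) → outA q
                                   ; {a} (inj₂ q) → ⊥-elim (subst (T ∘ x-or-s) q (alone a)) }) ps))
    (λ cl ps → through cl (All.map (Sum.map₂ λ (q , e) → outA q , e) ps))
    (λ { {[]} _ _ → s≤s z≤n
       ; {a ∷ _} _ ((_ , _ , q) ∷ _) → ⊥-elim (subst T (trans (sym q) (τ≡false a)) tt) })
  monochromatic-free-alone outA alone τ≡false hitA no-original through against {false} = no-blue-alone alone
    (λ cl _ → no-original cl (All.universal _ _))
    (λ cl ps → against cl (All.map (λ (q , e) → outA q , (λ ()) , e) ps))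

-- Assignment of roles by association lists

module _ {V : Set} (_≟ᵥ_ : (a b : V) → Dec (a ≡ b)) where

  label : List (V × Role) → V → Label
  label []             a = nothing
  label ((b , k) ∷ ts) a with a ≟ᵥ b
  ... | yes _ = just k
  ... | no _  = label ts a

  label-just : ∀ ts {a k} → label ts a ≡ just k → (a , k) ∈ ts
  label-just ((b , k) ∷ ts) {a} q with a ≟ᵥ b
  label-just ((b , k) ∷ ts) {a} refl | yes refl = here refl
  ... | no _ = there (label-just ts q)

  label-nothing : ∀ ts {a} → label ts a ≡ nothing → a ∉ map proj₁ ts
  label-nothing ((b , k) ∷ ts) {a} q a∈ with a ≟ᵥ b
  label-nothing ((b , k) ∷ ts) {a} () a∈          | yes _
  label-nothing ((b , k) ∷ ts) {a} q  (here a≡b)  | no a≢b = a≢b a≡b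
  label-nothing ((b , k) ∷ ts) {a} q  (there a∈)  | no _   = label-nothing ts q a∈

roster : {V : Set} (k₀ k₁ k₂ k₃ k⁺ : Role) → V → V → V → V → List V → List (V × Role)
roster k₀ k₁ k₂ k₃ k⁺ a t b c R =
  (a , k₀) ∷ (t , k₁) ∷ (b , k₂) ∷ (c , k₃) ∷ map (_, k⁺) R

∈-roster : {V : Set} → ∀ k₀ k₁ k₂ k₃ k⁺ (a t b c : V) R {u} → u ∈ a ∷ t ∷ b ∷ c ∷ R →
  u ∈ map proj₁ (roster k₀ k₁ k₂ k₃ k⁺ a t b c R)
∈-roster k₀ k₁ k₂ k₃ k⁺ a t b c R = subst (λ R′ → _ ∈ a ∷ t ∷ b ∷ c ∷ R′) (trans (sym (map-id R)) (map-∘ R))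

Valid : {V : Set} → (Role → V) → (sR rR : List V) → V × Role → Set
Valid point sR rR (a , k) = (T (single k) → a ≡ point k) × (k ≡ s⁺ → a ∈ sR) × (k ≡ r⁺ → a ∈ rR)

-- Recolouring around one clique or two

module Assembly (G : Graph) (χ : Colouring G) (m : ℕ) where
  open Search G χ
  open Switching G χ m
  open Switch

  module Labelled (ts : List (V × Role)) (point : Role → V) (sR rR : List V)
    (valid : All (Valid point sR rR) ts)
    (|sR|≤m : length sR ≤ m) (|rR|≤m : length rR ≤ m) (σ τ : V → Bool) where

    at : ∀ {a k} → label _≟_ ts a ≡ just k → Valid point sR rR (a , k)
    at q = All.lookup valid (label-just _≟_ ts q)

    open Recolour G χ m (label _≟_ ts) point sR rR |sR|≤m |rR|≤m
      (λ q → proj₁ (at q)) (λ q → proj₁ (proj₂ (at q)) refl) (λ q → proj₂ (proj₂ (at q)) refl) σ τ public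
      using (recoloured; monochromatic-free; monochromatic-free-alone)

  split-rest : ∀ {A k c B} (S : Switch G χ m c A B k) → length A ≡ 4 + m →
               ∃ λ b → ∃ λ d → ∃ λ R → A ↭ apex S ∷ tip S ∷ b ∷ d ∷ R × length R ≡ m
  split-rest S lenA = go (rest S) (perm S)
    where
      go : ∀ R → _ ↭ apex S ∷ tip S ∷ R → _
      go []          p with () ← trans (sym lenA) (↭-length p)
      go (_ ∷ [])    p with () ← trans (sym lenA) (↭-length p)
      go (b ∷ d ∷ R) p = b , d , R , p , cong (_∸ 4) (trans (sym (↭-length p)) lenA)

  Recolourable : Set
  Recolourable = ∃ λ χ′ → CliqueFree G χ′ (4 + m)

  only-red : ∀ {A} → Clique G χ true A → length A ≡ 4 + m →
             CliqueBound G χ false (λ _ → ⊤) (4 + m) → Found G χ m ⊎ Recolourable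
  only-red {A} clA lenA no-blue with extend clA lenA
  ... | inj₁ f = inj₁ f
  ... | inj₂ hitA
    with switch {k = 3 + m} clA lenA [] (λ cl _ → no-blue cl (All.universal _ _)) (s≤s (s≤s z≤n))
  ...   | inj₁ f = inj₁ f
  ...   | inj₂ S with split-rest S lenA
  ...     | b , d , R , p , lenR = inj₂ (L.recoloured ,
              L.monochromatic-free-alone
                (λ {a} q a∈ → label-nothing _≟_ ts {a} q (∈-roster x s₁ s₂ s₃ s⁺ _ _ b d R (∈-resp-↭ p a∈)))
                (λ a → alone a _ refl) (λ _ → refl) hitA no-blue (through-apex S) (against-tip S))
    where
      ts : List (V × Role)
      ts = roster x s₁ s₂ s₃ s⁺ (apex S) (tip S) b d R

      point : Role → V
      point x  = apex S
      point s₁ = tip S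
      point s₂ = b
      point _  = d

      module L = Labelled ts point R []
        (((λ _ → refl) , (λ ()) , λ ()) ∷ ((λ _ → refl) , (λ ()) , λ ()) ∷
         ((λ _ → refl) , (λ ()) , λ ()) ∷ ((λ _ → refl) , (λ ()) , λ ()) ∷
         AllP.map⁺ (All.tabulate λ a∈ → (λ ()) , (λ _ → a∈) , λ ()))
        (≤-reflexive lenR) z≤n (tint S) (λ _ → false)

      all-alone : All (λ (_ , k) → T (x-or-s (just k))) ts
      all-alone = tt ∷ tt ∷ tt ∷ tt ∷ AllP.map⁺ (All.universal (λ _ → tt) R)

      alone : ∀ a l → label _≟_ ts a ≡ l → T (x-or-s l)
      alone a nothing  _ = tt
      alone a (just k) q = All.lookup all-alone (label-just _≟_ ts {a} q)

  both-colours : ∀ {A B} → Clique G χ true A → length A ≡ 4 + m → Clique G χ false B → length B ≡ 4 + m →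
                 Found G χ m ⊎ Recolourable
  both-colours {A} {B} clA lenA clB lenB with extend clA lenA | extend clB lenB
  ... | inj₁ f    | _         = inj₁ f
  ... | inj₂ _    | inj₁ f    = inj₁ f
  ... | inj₂ hitA | inj₂ hitB
    with switch {k = 2 + m} clA lenA clB hitB (s≤s (s≤s z≤n))
       | switch {k = 2 + m} clB lenB clA hitA (s≤s (s≤s z≤n))
  ...   | inj₁ f  | _       = inj₁ f
  ...   | inj₂ _  | inj₁ f  = inj₁ f
  ...   | inj₂ S  | inj₂ S′ with split-rest S lenA | split-rest S′ lenB
  ...     | b , d , R , p , lenR | b′ , d′ , R′ , p′ , lenR′ = inj₂ (L.recoloured ,
              L.monochromatic-free
                (λ {a} q a∈ → ∉members {a} q (∈-++⁺ˡ
                  (∈-roster x s₁ s₂ s₃ s⁺ _ _ b d R (∈-resp-↭ p a∈))))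
                (λ {a} q a∈ → ∉members {a} q (∈-++⁺ʳ (map proj₁ tsA)
                  (∈-roster y r₁ r₂ r₃ r⁺ _ _ b′ d′ R′ (∈-resp-↭ p′ a∈))))
                (apex∉B S′) (apex∉B S) hitA hitB
                (through-apex S) (against-tip S) (through-apex S′) (against-tip S′))
    where
      tsA tsB : List (V × Role)
      tsA = roster x s₁ s₂ s₃ s⁺ (apex S) (tip S) b d R
      tsB = roster y r₁ r₂ r₃ r⁺ (apex S′) (tip S′) b′ d′ R′

      point : Role → V
      point x  = apex S
      point s₁ = tip S
      point s₂ = b
      point s₃ = d
      point y  = apex S′
      point r₁ = tip S′
      point r₂ = b′
      point _  = d′

      -- `label` takes the first entry, so a vertex common to `A` and `B` bears its role in `A`.
      module L = Labelled (tsA ++ tsB) point R R′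
        (AllP.++⁺
          (((λ _ → refl) , (λ ()) , λ ()) ∷ ((λ _ → refl) , (λ ()) , λ ()) ∷
           ((λ _ → refl) , (λ ()) , λ ()) ∷ ((λ _ → refl) , (λ ()) , λ ()) ∷
           AllP.map⁺ (All.tabulate λ a∈ → (λ ()) , (λ _ → a∈) , λ ()))
          (((λ _ → refl) , (λ ()) , λ ()) ∷ ((λ _ → refl) , (λ ()) , λ ()) ∷
           ((λ _ → refl) , (λ ()) , λ ()) ∷ ((λ _ → refl) , (λ ()) , λ ()) ∷
           AllP.map⁺ (All.tabulate λ a∈ → (λ ()) , (λ ()) , λ _ → a∈)))
        (≤-reflexive lenR) (≤-reflexive lenR′) (tint S) (tint S′)

      ∉members : ∀ {a} → label _≟_ (tsA ++ tsB) a ≡ nothing → a ∉ map proj₁ tsA ++ map proj₁ tsB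
      ∉members {a} q = subst (a ∉_) (map-++ proj₁ tsA tsB) (label-nothing _≟_ (tsA ++ tsB) q)

-- Cliques and copies of complete graphs

K-adj : ∀ {n} {i j : Fin n} → i ≢ j → T (adj (K n) i j)
K-adj {i = i} {j} i≢j = subst (T ∘ not) (sym (dec-false (i ≟ j) i≢j)) tt

K-adj⁻ : ∀ {n} {i j : Fin n} → T (adj (K n) i j) → i ≢ j
K-adj⁻ {n} {i} t refl = ¬loop (K n) {i} t

MonoCopy⇒Clique : ∀ {G χ c n} → MonoCopy G χ c (K n) → ∃ λ D → Clique G χ c D × length D ≡ n
MonoCopy⇒Clique (f , _ , edges) =
  tabulate f , AllPairsP.tabulate⁺ (λ {i} {j} i≢j → edges i j (K-adj i≢j)) , length-tabulate f

lookup-edge : ∀ {G χ c A} → Clique G χ c A → ∀ {i j} → i ≢ j → Edge G χ c (lookup A i) (lookup A j)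
lookup-edge {A = _ ∷ _} (es ∷ cl) {zero}  {zero}  i≢j = ⊥-elim (i≢j refl)
lookup-edge {A = _ ∷ A} (es ∷ cl) {zero}  {suc j} i≢j = All.lookup es (∈-lookup j)
lookup-edge {G} {χ} {c} {A = _ ∷ A} (es ∷ cl) {suc i} {zero} i≢j = Edge-sym G χ c (All.lookup es (∈-lookup i))
lookup-edge {G} {χ} {A = _ ∷ _} (es ∷ cl) {suc i} {suc j} i≢j = lookup-edge {G} {χ} cl (i≢j ∘ cong suc)

-- Entries at different positions are joined by an edge, which would be a loop if they were equal.
lookup-injective : ∀ {G χ c A} → Clique G χ c A → ∀ {i j} → lookup A i ≡ lookup A j → i ≡ j
lookup-injective {G} {χ} {c} {A} cl {i} {j} q = decidable-stable (i ≟ j) λ i≢j →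
  Edge-irrefl G χ c (subst (Edge G χ c (lookup A i)) (sym q) (lookup-edge {G} {χ} cl i≢j))

disjoint-cliques : ∀ {G χ c A M} → Clique G χ c A → Clique G χ c M → All (_∉ A) M →
                   MonoCopy G χ c (K (length A) ⊕ K (length M))
disjoint-cliques {G} {χ} {c} {A} {M} clA clM M∉A = f , injective , edges
  where
    f : Fin (length A + length M) → Fin (v G)
    f i = Sum.[ lookup A , lookup M ] (splitAt (length A) i)

    injective : ∀ {i j} → f i ≡ f j → i ≡ j
    injective {i} {j} q with splitAt (length A) i in p | splitAt (length A) j in p′
    ... | inj₁ a | inj₁ b with refl ← lookup-injective {G} {χ} clA q =
      trans (sym (Fin.splitAt⁻¹-↑ˡ p)) (Fin.splitAt⁻¹-↑ˡ p′)
    ... | inj₂ a | inj₂ b with refl ← lookup-injective {G} {χ} clM q =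
      trans (sym (Fin.splitAt⁻¹-↑ʳ p)) (Fin.splitAt⁻¹-↑ʳ p′)
    ... | inj₁ a | inj₂ b = ⊥-elim (All.lookup M∉A (∈-lookup b) (subst (_∈ A) q (∈-lookup a)))
    ... | inj₂ a | inj₁ b = ⊥-elim (All.lookup M∉A (∈-lookup a) (subst (_∈ A) (sym q) (∈-lookup b)))

    edges : ∀ i j → T (adj (K (length A) ⊕ K (length M)) i j) → Edge G χ c (f i) (f j)
    edges i j t with splitAt (length A) i | splitAt (length A) j
    ... | inj₁ a | inj₁ b = lookup-edge {G} {χ} clA (K-adj⁻ t)
    ... | inj₂ a | inj₂ b = lookup-edge {G} {χ} clM (K-adj⁻ t)

-- The two implications

found⇒MonoCopy : ∀ {G χ m} → Found G χ m → Σ Bool λ c → MonoCopy G χ c (K (4 + m) ⊕ K (3 + m))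
found⇒MonoCopy {G} {χ} (c , A , M , clA , lenA , clM , M∉A , lenM) =
  c , subst₂ (λ a b → MonoCopy G χ c (K a ⊕ K b)) lenA lenM (disjoint-cliques {G} {χ} clA clM M∉A)

-- A recolouring free of monochromatic cliques of size n would contradict the hypothesis on `G`, so
-- only `Found` remains.
found-from-red : ∀ {G m} → G ⟶ K (4 + m) → ∀ {χ A} → Clique G χ true A → length A ≡ 4 + m → Found G χ m
found-from-red {G} {m} arrow {χ} clA lenA = Sum.[ id , absurd ] result
  where
    open Assembly G χ m

    result : Found G χ m ⊎ Recolourable
    result with Search.clique? G χ false (4 + m) (λ _ → yes tt)
    ... | yes (B , clB , _ , lenB) = both-colours clA lenA clB lenB
    ... | no none                  = only-red clA lenA (Search.clique-bound G χ none)

    absurd : Recolourable → Found G χ m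
    absurd (χ′ , free) with arrow χ′
    ... | c , copy with MonoCopy⇒Clique {G} {χ′} copy
    ...   | D , cl , len = ⊥-elim (free cl (≤-reflexive (sym len)))

-- Reduces the case of a blue clique to that of a red one.
swap-colours : ∀ {G} → Colouring G → Colouring G
swap-colours χ = record { col = λ a b → not (col χ a b) ; colSym = λ a b → cong not (colSym χ a b) }

not-swap : ∀ {b c} → not b ≡ c → b ≡ not c
not-swap {b} q = trans (sym (not-involutive b)) (cong not q)

unswap : ∀ {G χ c L} → Clique G (swap-colours χ) c L → Clique G χ (not c) L
unswap = AllPairs.map λ (e , q) → e , not-swap q

swap : ∀ {G χ L} → Clique G χ false L → Clique G (swap-colours χ) true L
swap = AllPairs.map λ (e , q) → e , cong not q

found : ∀ {G m} → G ⟶ K (4 + m) → ∀ χ → Found G χ m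
found {G} {m} arrow χ with arrow χ
... | c , copy with c | MonoCopy⇒Clique {G} {χ} copy
...   | true  | A , cl , len = found-from-red arrow {χ} cl len
...   | false | A , cl , len
  with found-from-red arrow {swap-colours χ} (swap {G} {χ} cl) len
...     | c′ , A′ , M , clA′ , lenA′ , clM , M∉A′ , lenM =
  not c′ , A′ , M , unswap {G} {χ} clA′ , lenA′ , unswap {G} {χ} clM , M∉A′ , lenM

left-copy : ∀ {G χ c} H₁ H₂ → MonoCopy G χ c (H₁ ⊕ H₂) → MonoCopy G χ c H₁
left-copy H₁ H₂ (f , inj , edges) =
  f ∘ (_↑ˡ v H₂) , (λ q → Fin.↑ˡ-injective (v H₂) _ _ (inj q)) , λ a b t → edges _ _ (left-adj a b t)
  where
    left-adj : ∀ a b → T (adj H₁ a b) → T (adj (H₁ ⊕ H₂) (a ↑ˡ v H₂) (b ↑ˡ v H₂))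
    left-adj a b t rewrite Fin.splitAt-↑ˡ (v H₁) a (v H₂) | Fin.splitAt-↑ˡ (v H₁) b (v H₂) = t

theorem1 : (n : ℕ) → 4 ≤ n → (G : Graph) → (G ⟶ K n) ⇔ (G ⟶ (K n ⊕ K (n ∸ 1)))
theorem1 (suc (suc (suc (suc m)))) _ G = mk⇔
  (λ arrow χ → found⇒MonoCopy {G} {χ} (found arrow χ))
  (λ arrow χ → map₂ (left-copy {G} {χ} (K (4 + m)) (K (3 + m))) (arrow χ))
theorem1 0 ()
theorem1 1 (s≤s ())
theorem1 2 (s≤s (s≤s ()))
theorem1 3 (s≤s (s≤s (s≤s ())))
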